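{- Let $n\ge 1$, $r\ge 1$ and $k$ be integers. (i) If $n$ is odd, $0\le k<n+2$, $r\ge n+2$, and $r\equiv k\pmod{n+2}$, then $$\mathcal{D}(L_n,r)\le \frac{(n+2)^{n-1}}{2^{n}(r-k)^{n-1}}.$$ (ii) If $n$ is even, $0\le k<(n+2)/2$, $r\ge (n+2)/2$, and $r\equiv k\pmod{(n+2)/2}$, then $$\mathcal{D}(L_n,r)\le \frac{(n+2)^{n-1}}{2^{n}(r-k)^{n-1}}.$$
   Context: $L_n$ denotes the $n$-dimensional lattice graph: its vertex set is $\mathbb{Z}^n$, and $\{(x_1,\ldots,x_n),(y_1,\ldots,y_n)\}$ is an edge if and only if $\sum_{i=1}^n |x_i-y_i|=1$. For a connected undirected graph $G$ with graph distance $d$, put $B_r(v)=\{u\in V(G): d(u,v)\le r\}$. A code is a nonempty subset $C\subseteq V(G)$. A code $C$ is $r$-identifying if (1) $B_r(v)\cap C\neq\emptyset$ for all $v\in V(G)$, and (2) $B_r(u)\cap C\ne B_r(v)\cap C$ for all $u\neq v$ in $V(G)$. The density of a code $C$ in $L_n$ is $\limsup_{m\to\infty} |C\cap Q_m|/|Q_m|$, where $Q_m$ is the set of $(x_1,\ldots,x_n)\in\mathbb{Z}^n$ with $|x_i|\le m$ for all $i$. $\mathcal{D}(L_n,r)$ denotes the minimum possible density (the infimum over all $r$-identifying codes) of an $r$-identifying code for $L_n$. -}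

module Defs where

open import Level using (Level; 0ℓ; _⊔_) renaming (suc to lsuc)
open import Data.Nat.Base as ℕ using (ℕ; zero; suc; NonZero)
import Data.Nat.Properties as ℕ
open import Data.Integer.Base as ℤ using (ℤ; +_; -[1+_]; ∣_∣)
import Data.Integer.Properties as ℤ
import Data.Integer.Divisibility as ℤ
open import Data.Rational.Base as ℚ using (ℚ)
import Data.Rational.Properties as ℚ
open import Data.List.Base as List using (List; []; _∷_; _++_; length; filter; upTo; cartesianProductWith)
open import Data.List.Membership.Propositional using (_∈_)
open import Data.List.Membership.Propositional.Properties
  using (∈-map⁺; ∈-map⁻; ∈-++⁺ˡ; ∈-++⁺ʳ; ∈-++⁻; ∈-upTo⁺; ∈-upTo⁻;
         ∈-cartesianProductWith⁺; ∈-cartesianProductWith⁻)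
open import Data.List.Relation.Unary.Any using (here)
import Data.List.Relation.Unary.All as ListAll
open import Data.List.Relation.Unary.AllPairs using ([]; _∷_)
open import Data.List.Relation.Unary.Unique.Propositional using (Unique)
import Data.List.Relation.Unary.Unique.Propositional.Properties as Unique
open import Data.Vec.Base as Vec using (Vec; []; _∷_; zipWith)
import Data.Vec.Properties as Vec
open import Data.Vec.Relation.Unary.All using (All; []; _∷_)
open import Data.Product.Base using (∃-syntax; Σ-syntax; _×_; _,_)
open import Data.Sum.Base using (inj₁; inj₂)
open import Function.Bundles using (_⇔_; mk⇔)
open import Relation.Binary.Core using (Rel)
open import Relation.Binary.Definitions using (Symmetric; Irreflexive)
open import Relation.Binary.PropositionalEquality
open import Relation.Nullary using (¬_)
open import Relation.Unary using (Pred; Decidable; Satisfiable; _∩_; _≐_)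

private variable
  i ℓ ℓ′ : Level

-- A real x, or ±∞, is represented by its open upper cut { q ∈ ℚ | x < q }.
-- Infima and suprema of arbitrary families then exist without classical
-- principles, so limsup and inf need no attainment or convergence
-- hypotheses.

record UpperReal ℓ : Set (lsuc ℓ) where
  field
    Above   : Pred ℚ ℓ
    upward  : ∀ {p q} → p ℚ.< q → Above p → Above q
    rounded : ∀ {q} → Above q → ∃[ p ] p ℚ.< q × Above p

open UpperReal public

infix 4 _≤ᵘ_

_≤ᵘ_ : UpperReal ℓ → UpperReal ℓ′ → Set (ℓ ⊔ ℓ′)
x ≤ᵘ y = ∀ {q} → Above y q → Above x q

fromℚ : ℚ → UpperReal 0ℓ
fromℚ x .Above q          = x ℚ.< q
fromℚ x .upward p<q x<p   = ℚ.<-trans x<p p<q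
fromℚ x .rounded x<q      = let p , x<p , p<q = ℚ.<-dense x<q in p , p<q , x<p

⨅ : {I : Set i} → (I → UpperReal ℓ) → UpperReal (i ⊔ ℓ)
⨅ x .Above q                = ∃[ j ] Above (x j) q
⨅ x .upward p<q (j , xⱼ<p)  = j , upward (x j) p<q xⱼ<p
⨅ x .rounded (j , xⱼ<q)     = let p , p<q , xⱼ<p = rounded (x j) xⱼ<q in p , p<q , j , xⱼ<p

-- The intersection of the cuts of the x j need not be open, hence the
-- uniform bound p strictly below q.

⨆ : {I : Set i} → (I → UpperReal ℓ) → UpperReal (i ⊔ ℓ)
⨆ x .Above q                    = ∃[ p ] p ℚ.< q × (∀ j → Above (x j) p)
⨆ x .upward q<q′ (p , p<q , x<p) = p , ℚ.<-trans p<q q<q′ , x<p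
⨆ x .rounded (p , p<q , x<p)    =
  let s , p<s , s<q = ℚ.<-dense p<q in s , s<q , p , p<s , x<p

limsup : (ℕ → ℚ) → UpperReal 0ℓ
limsup a = ⨅ λ M → ⨆ λ m → fromℚ (a (M ℕ.+ m))

record Graph : Set₁ where
  field
    V          : Set
    Adj        : Rel V 0ℓ
    adj-sym    : Symmetric Adj
    adj-irrefl : Irreflexive _≡_ Adj

module _ (G : Graph) where
  open Graph G using (V; Adj)

  data Walk : V → V → ℕ → Set where
    nil  : ∀ {u} → Walk u u 0
    cons : ∀ {u v w l} → Adj u v → Walk v w l → Walk u w (suc l)

  IsDistance : V → V → ℕ → Set
  IsDistance u v d = Walk u v d × (∀ {l} → Walk u v l → d ℕ.≤ l)

  Ball : ℕ → V → Pred V 0ℓ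
  Ball r v u = ∃[ d ] IsDistance u v d × d ℕ.≤ r

  -- Membership is required to be decidable so that the elements of a code
  -- inside a finite set can be counted.

  record Code : Set₁ where
    field
      Member   : Pred V 0ℓ
      member?  : Decidable Member
      nonempty : Satisfiable Member

  record IsIdentifying (r : ℕ) (C : Code) : Set where
    open Code C
    field
      covering   : ∀ v → Satisfiable (Ball r v ∩ Member)
      separating : ∀ {u v} → u ≢ v → ¬ ((Ball r u ∩ Member) ≐ (Ball r v ∩ Member))

‖_-_‖₁ : ∀ {n} → Vec ℤ n → Vec ℤ n → ℕ
‖ x - y ‖₁ = Vec.sum (zipWith (λ a b → ∣ a ℤ.- b ∣) x y)

‖-‖₁-comm : ∀ {n} (x y : Vec ℤ n) → ‖ x - y ‖₁ ≡ ‖ y - x ‖₁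
‖-‖₁-comm []      []      = refl
‖-‖₁-comm (a ∷ x) (b ∷ y) = cong₂ ℕ._+_ (ℤ.∣i-j∣≡∣j-i∣ a b) (‖-‖₁-comm x y)

‖x-x‖₁≡0 : ∀ {n} (x : Vec ℤ n) → ‖ x - x ‖₁ ≡ 0
‖x-x‖₁≡0 []      = refl
‖x-x‖₁≡0 (a ∷ x) = cong₂ ℕ._+_ (cong ∣_∣ (ℤ.+-inverseʳ a)) (‖x-x‖₁≡0 x)

L : ℕ → Graph
L n = record
  { V          = Vec ℤ n
  ; Adj        = λ x y → ‖ x - y ‖₁ ≡ 1
  ; adj-sym    = λ {x} {y} xy → trans (‖-‖₁-comm y x) xy
  ; adj-irrefl = λ { {x} refl xx → ℕ.0≢1+n (trans (sym (‖x-x‖₁≡0 x)) xx) }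
  }

interval : ℕ → List ℤ
interval m = List.map +_ (upTo (suc m)) ++ List.map -[1+_] (upTo m)

-- Qₘ as a duplicate-free list, see ∈-Q and Q-unique below.

Q : ∀ n → ℕ → List (Vec ℤ n)
Q zero    m = [] ∷ []
Q (suc n) m = cartesianProductWith _∷_ (interval m) (Q n m)

∈-interval⁺ : ∀ {m} z → ∣ z ∣ ℕ.≤ m → z ∈ interval m
∈-interval⁺     (+ a)    a≤m = ∈-++⁺ˡ (∈-map⁺ +_ (∈-upTo⁺ (ℕ.s≤s a≤m)))
∈-interval⁺ {m} -[1+ a ] a<m = ∈-++⁺ʳ (List.map +_ (upTo (suc m))) (∈-map⁺ -[1+_] (∈-upTo⁺ a<m))

∈-interval⁻ : ∀ {m z} → z ∈ interval m → ∣ z ∣ ℕ.≤ m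
∈-interval⁻ {m} z∈ with ∈-++⁻ (List.map +_ (upTo (suc m))) z∈
... | inj₁ p with _ , a∈ , refl ← ∈-map⁻ +_ p     = ℕ.s≤s⁻¹ (∈-upTo⁻ a∈)
... | inj₂ p with _ , a∈ , refl ← ∈-map⁻ -[1+_] p = ∈-upTo⁻ a∈

interval-unique : ∀ m → Unique (interval m)
interval-unique m = Unique.++⁺
  (Unique.map⁺ ℤ.+-injective (Unique.upTo⁺ (suc m)))
  (Unique.map⁺ ℤ.-[1+-injective (Unique.upTo⁺ m))
  λ (p , q) → disjoint (∈-map⁻ +_ p) (∈-map⁻ -[1+_] q)
  where
  disjoint : ∀ {z} {as bs : List ℕ} → ∃[ a ] a ∈ as × z ≡ + a →
             ¬ (∃[ b ] b ∈ bs × z ≡ -[1+ b ])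
  disjoint (_ , _ , refl) (_ , _ , ())

∈-Q : ∀ {n m} {x : Vec ℤ n} → (x ∈ Q n m) ⇔ All (λ z → ∣ z ∣ ℕ.≤ m) x
∈-Q = mk⇔ to from
  where
  to : ∀ {n m} {x : Vec ℤ n} → x ∈ Q n m → All (λ z → ∣ z ∣ ℕ.≤ m) x
  to {zero}  {x = []} _ = []
  to {suc n} {m} x∈ with _ , _ , z∈ , y∈ , refl ← ∈-cartesianProductWith⁻ _∷_ (interval m) (Q n m) x∈
    = ∈-interval⁻ z∈ ∷ to y∈

  from : ∀ {n m} {x : Vec ℤ n} → All (λ z → ∣ z ∣ ℕ.≤ m) x → x ∈ Q n m
  from []                 = here refl
  from (_∷_ {x = z} p ps) = ∈-cartesianProductWith⁺ _∷_ (∈-interval⁺ z p) (from ps)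

Q-unique : ∀ n m → Unique (Q n m)
Q-unique zero    m = ListAll.[] ∷ []
Q-unique (suc n) m =
  Unique.cartesianProductWith⁺ _∷_ Vec.∷-injective (interval-unique m) (Q-unique n m)

∣Q∣≢0 : ∀ n m → NonZero (length (Q n m))
∣Q∣≢0 zero    m = _
∣Q∣≢0 (suc n) m with Q n m | ∣Q∣≢0 n m
... | _ ∷ _ | _ = _

density : ∀ {n} → Code (L n) → UpperReal 0ℓ
density {n} C = limsup λ m →
  ℚ._/_ (+ length (filter member? (Q n m))) (length (Q n m)) ⦃ ∣Q∣≢0 n m ⦄
  where open Code C

𝓓 : ℕ → ℕ → UpperReal (lsuc 0ℓ)
𝓓 n r = ⨅ {I = Σ[ C ∈ Code (L n) ] IsIdentifying (L n) r C} λ (C , _) → density C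

infix 4 _≡_[mod_]

_≡_[mod_] : ℕ → ℕ → ℕ → Set
a ≡ b [mod m ] = (+ m) ℤ.∣ (+ a ℤ.- + b)

denominator≢0 : ∀ n {r k} → k ℕ.< r → NonZero (2 ℕ.^ n ℕ.* (r ℕ.∸ k) ℕ.^ (n ℕ.∸ 1))
denominator≢0 n {r} {k} k<r = ℕ.m*n≢0 _ _ ⦃ ℕ.m^n≢0 2 n ⦄ ⦃ ℕ.m^n≢0 (r ℕ.∸ k) (n ℕ.∸ 1) ⦃ ℕ.>-nonZero (ℕ.m<n⇒0<n∸m k<r) ⦄ ⦄

{-# OPTIONS --safe #-}
module Submission where

open import Defs
open import Data.Nat.Base as ℕ using (ℕ; zero; suc; z≤n; s≤s; NonZero; _+_; _*_; _∸_; _^_; _≤_; _<_; _/_)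
open import Data.Nat.Divisibility using (_∣_; divides; ∣m∣n⇒∣m+n; ∣-refl; ∣1⇒≡1)
import Data.Nat.DivMod as ℕ
import Data.Nat.Properties as ℕ
open import Data.Nat.Properties using (<-≤-trans; module ≤-Reasoning)
import Data.Nat.Tactic.RingSolver as ℕ-Solver
open import Data.Integer.Base as ℤ using (ℤ; +_; -[1+_]; +[1+_]; ∣_∣)
import Data.Integer.DivMod as ℤ
import Data.Integer.Divisibility.Signed as ℤ
open import Data.Integer.Divisibility.Signed using (divides)
import Data.Integer.Properties as ℤ
import Data.Integer.Tactic.RingSolver as ℤ-Solver
open import Data.List.Base as List using (List; []; _∷_; length; filter; upTo; cartesianProductWith)
open import Data.List.Membership.Propositional using (_∈_)
open import Data.List.Membership.Propositional.Properties using (∈-filter⁻; ∈-upTo⁺; ∈-cartesianProductWith⁺)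
import Data.List.Properties as List
open import Data.List.Relation.Binary.Subset.Propositional using () renaming (_⊆_ to _⊆ᴸ_)
import Data.List.Relation.Unary.All as ListAll
open import Data.List.Relation.Unary.AllPairs using (_∷_)
open import Data.List.Relation.Unary.Any using (here; there; index; _─_)
open import Data.List.Relation.Unary.Unique.Propositional using (Unique)
import Data.List.Relation.Unary.Unique.Propositional.Properties as Unique
open import Data.Product.Base using (_×_; _,_; ∃-syntax; proj₁)
open import Data.Rational.Base as ℚ using (ℚ; mkℚ) renaming (_/_ to _÷_)
import Data.Rational.Properties as ℚ
open import Data.Rational.Unnormalised.Base as ℚᵘ using (mkℚᵘ)
import Data.Rational.Unnormalised.Properties as ℚᵘ
open import Data.Sum.Base using (_⊎_; inj₁; inj₂; [_,_]′)
open import Data.Vec.Base as Vec using (Vec; []; _∷_; tail; replicate)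
open import Data.Vec.Relation.Unary.All as All using (All; []; _∷_)
open import Function.Base using (_∘_)
open import Function.Bundles using (module Equivalence)
open import Relation.Binary.PropositionalEquality
open import Relation.Nullary using (¬_; yes; no; contradiction)
open import Relation.Nullary.Decidable using (_×-dec_)
open import Relation.Unary using (_∩_; _⊆_; Satisfiable)

-- Let T = 2(r − k)/(n + 2), an integer in both cases, and let C consist of
-- the vertices of even coordinate sum whose coordinates other than the first
-- are all multiples of T: parallel lines, every second point of each, of
-- density 1/(2Tⁿ⁻¹).  Fix a line of C, through the multiple x of T.  For
-- u = a ∷ u′ the ball of u meets it in the points w ∷ x of even sum with
-- |a − w| ≤ ρ(u) − ‖u′ − x‖, where ρ(u) ∈ {r − 1, r} depends only on the
-- parity of u; the extremes of this interval belong to C.  Hence if u and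
-- v = b ∷ v′ have the same code points in their balls, then a = b, and
-- ‖u′ − x‖ − ‖v′ − x‖ is the same for all lines x that the ball of u meets.
-- Since (n + 2)T ≤ 2r, these include lines on both sides of u′ in every
-- direction, and that forces u′ = v′.

-- Balls in the lattice graph

∣-∣-triangle : ∀ a b c → ∣ a ℤ.- c ∣ ≤ ∣ a ℤ.- b ∣ + ∣ b ℤ.- c ∣
∣-∣-triangle a b c =
  subst (λ i → ∣ i ∣ ≤ ∣ a ℤ.- b ∣ + ∣ b ℤ.- c ∣) (telescope a b c) (ℤ.∣i+j∣≤∣i∣+∣j∣ (a ℤ.- b) (b ℤ.- c))
  where
  telescope : ∀ a b c → (a ℤ.- b) ℤ.+ (b ℤ.- c) ≡ a ℤ.- c
  telescope = ℤ-Solver.solve-∀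

‖-‖₁-triangle : ∀ {n} (x y z : Vec ℤ n) → ‖ x - z ‖₁ ≤ ‖ x - y ‖₁ + ‖ y - z ‖₁
‖-‖₁-triangle []      []      []      = z≤n
‖-‖₁-triangle (a ∷ x) (b ∷ y) (c ∷ z) = begin
  ∣ a ℤ.- c ∣ + ‖ x - z ‖₁
    ≤⟨ ℕ.+-mono-≤ (∣-∣-triangle a b c) (‖-‖₁-triangle x y z) ⟩
  (∣ a ℤ.- b ∣ + ∣ b ℤ.- c ∣) + (‖ x - y ‖₁ + ‖ y - z ‖₁)
    ≡⟨ interchange ∣ a ℤ.- b ∣ ∣ b ℤ.- c ∣ ‖ x - y ‖₁ ‖ y - z ‖₁ ⟩
  (∣ a ℤ.- b ∣ + ‖ x - y ‖₁) + (∣ b ℤ.- c ∣ + ‖ y - z ‖₁) ∎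
  where
  open ≤-Reasoning
  interchange : ∀ p q s t → (p + q) + (s + t) ≡ (p + s) + (q + t)
  interchange = ℕ-Solver.solve-∀

-- Every edge has ℓ¹-length 1, so the triangle inequality adds up along the walk. With `geodesic`
-- this identifies the graph distance with the ℓ¹-distance.
‖-‖₁≤length : ∀ {n} {x y : Vec ℤ n} {l} → Walk (L n) x y l → ‖ x - y ‖₁ ≤ l
‖-‖₁≤length {x = x} nil = ℕ.≤-reflexive (‖x-x‖₁≡0 x)
‖-‖₁≤length {x = x} {y} (cons {v = v} xv w) = begin
  ‖ x - y ‖₁               ≤⟨ ‖-‖₁-triangle x v y ⟩
  ‖ x - v ‖₁ + ‖ v - y ‖₁  ≤⟨ ℕ.+-mono-≤ (ℕ.≤-reflexive xv) (‖-‖₁≤length w) ⟩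
  _                        ∎
  where open ≤-Reasoning

‖x-y‖₁≡0⇒x≡y : ∀ {n} (x y : Vec ℤ n) → ‖ x - y ‖₁ ≡ 0 → x ≡ y
‖x-y‖₁≡0⇒x≡y []      []      _ = refl
‖x-y‖₁≡0⇒x≡y (a ∷ x) (b ∷ y) e = cong₂ _∷_
  (ℤ.i-j≡0⇒i≡j a b (ℤ.∣i∣≡0⇒i≡0 (ℕ.m+n≡0⇒m≡0 _ e)))
  (‖x-y‖₁≡0⇒x≡y x y (ℕ.m+n≡0⇒n≡0 ∣ a ℤ.- b ∣ e))

stepℤ : ∀ a b {j} → ∣ a ℤ.- b ∣ ≡ suc j → ∃[ c ] ∣ a ℤ.- c ∣ ≡ 1 × ∣ c ℤ.- b ∣ ≡ j
stepℤ a b {j} e with a ℤ.- b in eq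
... | +[1+ k ] = a ℤ.- + 1 , cong ∣_∣ (cancel a (+ 1)) , trans (cong ∣_∣ down) (ℕ.suc-injective e)
  where
  cancel : ∀ a d → a ℤ.- (a ℤ.- d) ≡ d
  cancel = ℤ-Solver.solve-∀
  shift : ∀ a b d → (a ℤ.- d) ℤ.- b ≡ (a ℤ.- b) ℤ.- d
  shift = ℤ-Solver.solve-∀
  down : (a ℤ.- + 1) ℤ.- b ≡ + k
  down = trans (shift a b (+ 1)) (cong (ℤ._- + 1) eq)
... | -[1+ k ] = a ℤ.+ + 1 , cong ∣_∣ (cancel a (+ 1)) , trans (cong ∣_∣ up) (trans (ℤ.∣-i∣≡∣i∣ (+ k)) (ℕ.suc-injective e))
  where
  cancel : ∀ a d → a ℤ.- (a ℤ.+ d) ≡ ℤ.- d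
  cancel = ℤ-Solver.solve-∀
  shift : ∀ a b d → (a ℤ.+ d) ℤ.- b ≡ (a ℤ.- b) ℤ.+ d
  shift = ℤ-Solver.solve-∀
  neg-pred : ∀ m → ℤ.- (+ 1 ℤ.+ m) ℤ.+ + 1 ≡ ℤ.- m
  neg-pred = ℤ-Solver.solve-∀
  up : (a ℤ.+ + 1) ℤ.- b ≡ ℤ.- + k
  up = trans (shift a b (+ 1)) (trans (cong (ℤ._+ + 1) eq) (neg-pred (+ k)))

-- The first coordinate in which x and y differ is moved by one towards y; the others stay.
step : ∀ {n} (x y : Vec ℤ n) {l} → ‖ x - y ‖₁ ≡ suc l →
       ∃[ z ] ‖ x - z ‖₁ ≡ 1 × ‖ z - y ‖₁ ≡ l
step []      []      ()
step (a ∷ x) (b ∷ y) {l} e with ∣ a ℤ.- b ∣ in eq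
... | zero  = let z , xz , zy = step x y e in
  a ∷ z , cong₂ _+_ (cong ∣_∣ (ℤ.+-inverseʳ a)) xz , cong₂ _+_ eq zy
... | suc j = let c , ac , cb = stepℤ a b eq in
  c ∷ x , cong₂ _+_ ac (‖x-x‖₁≡0 x) , trans (cong (_+ ‖ x - y ‖₁) cb) (ℕ.suc-injective e)

geodesic : ∀ {n} (x y : Vec ℤ n) l → ‖ x - y ‖₁ ≡ l → Walk (L n) x y l
geodesic x y zero    e with refl ← ‖x-y‖₁≡0⇒x≡y x y e = nil
geodesic x y (suc l) e = let z , xz , zy = step x y e in cons xz (geodesic z y l zy)

ball⁺ : ∀ {n r} {v u : Vec ℤ n} → ‖ v - u ‖₁ ≤ r → Ball (L n) r v u
ball⁺ {v = v} {u} p =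
  ‖ u - v ‖₁ , (geodesic u v _ refl , ‖-‖₁≤length) , subst (_≤ _) (‖-‖₁-comm v u) p

ball⁻ : ∀ {n r} {v u : Vec ℤ n} → Ball (L n) r v u → ‖ v - u ‖₁ ≤ r
ball⁻ {v = v} {u} (_ , (w , _) , d≤r) =
  subst (_≤ _) (‖-‖₁-comm u v) (ℕ.≤-trans (‖-‖₁≤length w) d≤r)

-- Parity of distances

total : ∀ {n} → Vec ℤ n → ℤ
total []      = + 0
total (a ∷ x) = a ℤ.+ total x

2∣∣i∣-i : ∀ i → + 2 ℤ.∣ + ∣ i ∣ ℤ.- i
2∣∣i∣-i (+ n)    = divides (+ 0) (ℤ.+-inverseʳ (+ n))
2∣∣i∣-i -[1+ n ] = divides (+ suc n) (double (+ suc n))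
  where
  double : ∀ i → i ℤ.+ i ≡ i ℤ.* + 2
  double = ℤ-Solver.solve-∀

-- Coordinatewise |i| ≡ i mod 2, because |i| - i is 0 or 2|i|.
‖-‖₁-parity : ∀ {n} (x y : Vec ℤ n) → + 2 ℤ.∣ + ‖ x - y ‖₁ ℤ.- (total x ℤ.- total y)
‖-‖₁-parity []      []      = divides (+ 0) refl
‖-‖₁-parity (a ∷ x) (b ∷ y) = subst (+ 2 ℤ.∣_)
  (regroup (+ ∣ a ℤ.- b ∣) (+ ‖ x - y ‖₁) a b (total x) (total y))
  (ℤ.∣m∣n⇒∣m+n (2∣∣i∣-i (a ℤ.- b)) (‖-‖₁-parity x y))
  where
  regroup : ∀ p q a b s t → (p ℤ.- (a ℤ.- b)) ℤ.+ (q ℤ.- (s ℤ.- t)) ≡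
                            (p ℤ.+ q) ℤ.- ((a ℤ.+ s) ℤ.- (b ℤ.+ t))
  regroup = ℤ-Solver.solve-∀

-- The distance from a vertex of coordinate sum s to a vertex of even
-- coordinate sum is ≡ s mod 2, so within the code a ball of radius r is
-- a ball of radius ρ.

record EffectiveRadius (r : ℕ) (s : ℤ) : Set where
  field
    ρ       : ℕ
    ρ≤r     : ρ ≤ r
    r≤1+ρ   : r ≤ suc ρ
    parity  : + 2 ℤ.∣ + ρ ℤ.- s
    maximal : ∀ {d} → d ≤ r → + 2 ℤ.∣ + d ℤ.- s → d ≤ ρ

-- ρ is r or r - 1, whichever has the parity of s; r ≥ 1 keeps r - 1 a natural number.
effectiveRadius : ∀ {r} → 1 ≤ r → ∀ s → EffectiveRadius r s
effectiveRadius {suc r} _ s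
  with (+ suc r ℤ.- s) ℤ.%ℕ 2 | ℤ.n%ℕd<d (+ suc r ℤ.- s) 2 | ℤ.a≡a%ℕn+[a/ℕn]*n (+ suc r ℤ.- s) 2
... | 0 | _ | e = record
  { ρ = suc r ; ρ≤r = ℕ.≤-refl ; r≤1+ρ = ℕ.n≤1+n _
  ; parity = divides ((+ suc r ℤ.- s) ℤ./ℕ 2) (trans e (ℤ.+-identityˡ _)) ; maximal = λ d≤r _ → d≤r }
... | 1 | _ | e = record
  { ρ = r ; ρ≤r = ℕ.n≤1+n r ; r≤1+ρ = ℕ.≤-refl ; parity = even
  -- The value d = `suc r` has the wrong parity, so d ≤ `suc r` tightens to d ≤ r.
  ; maximal = λ d≤ 2∣ → ℕ.s≤s⁻¹ (ℕ.≤∧≢⇒< d≤ λ { refl → odd 2∣ }) }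
  where
  q = (+ suc r ℤ.- s) ℤ./ℕ 2
  pred : ∀ R s → R ℤ.- s ≡ ((+ 1 ℤ.+ R) ℤ.- s) ℤ.- + 1
  pred = ℤ-Solver.solve-∀
  drop : ∀ x → (+ 1 ℤ.+ x) ℤ.- + 1 ≡ x
  drop = ℤ-Solver.solve-∀
  even : + 2 ℤ.∣ + r ℤ.- s
  even = divides q (trans (pred (+ r) s) (trans (cong (ℤ._- + 1) e) (drop (q ℤ.* + 2))))
  odd : ¬ (+ 2 ℤ.∣ + suc r ℤ.- s)
  odd 2∣ with () ← ∣1⇒≡1 (ℤ.∣⇒∣ᵤ {+ 2} {+ 1} (ℤ.∣m+n∣n⇒∣m (subst (+ 2 ℤ.∣_) e 2∣) (divides q refl)))
... | suc (suc _) | s≤s (s≤s ()) | _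

-- Lines through multiples of T

compareℤ : ∀ a b → a ≡ b ⊎ (∃[ j ] b ≡ a ℤ.+ + suc j) ⊎ (∃[ j ] a ≡ b ℤ.+ + suc j)
compareℤ a b with a ℤ.- b in eq
... | + 0      = inj₁ (ℤ.i-j≡0⇒i≡j a b eq)
... | +[1+ j ] = inj₂ (inj₂ (j , trans (split a b) (cong (λ i → b ℤ.+ i) eq)))
  where
  split : ∀ a b → a ≡ b ℤ.+ (a ℤ.- b)
  split = ℤ-Solver.solve-∀
... | -[1+ j ] = inj₂ (inj₁ (j , trans (split a b) (cong (λ i → a ℤ.- i) eq)))
  where
  split : ∀ a b → b ≡ a ℤ.- (a ℤ.- b)
  split = ℤ-Solver.solve-∀

-- Both terms are positive, so a unit of each cancels; the strictness here becomes the strictness of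
-- `gap` in `witness-head`.
∣⊖∣<+ : ∀ m n → ∣ suc m ℤ.⊖ suc n ∣ < suc m + suc n
∣⊖∣<+ m n = begin-strict
  ∣ suc m ℤ.⊖ suc n ∣  ≡⟨ cong ∣_∣ (trans (ℤ.[1+m]⊖[1+n]≡m⊖n m n) (sym (ℤ.m-n≡m⊖n m n))) ⟩
  ∣ + m ℤ.- + n ∣      ≤⟨ ℤ.∣i-j∣≤∣i∣+∣j∣ (+ m) (+ n) ⟩
  m + n                <⟨ ℕ.+-mono-<-≤ (ℕ.n<1+n m) (ℕ.n≤1+n n) ⟩
  suc m + suc n        ∎
  where open ≤-Reasoning

-- w lies beyond a as seen from b, so that a is between b and w and the distances add up.
extend : ∀ a b h → ∃[ w ] ∣ a ℤ.- w ∣ ≡ h × ∣ b ℤ.- w ∣ ≡ ∣ b ℤ.- a ∣ + h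
extend a b h with b ℤ.- a in eq
... | + j      = a ℤ.- + h , cong ∣_∣ (cancel a (+ h))
                           , cong ∣_∣ (trans (shift a b (+ h)) (cong (ℤ._+ + h) eq))
  where
  cancel : ∀ a h → a ℤ.- (a ℤ.- h) ≡ h
  cancel = ℤ-Solver.solve-∀
  shift : ∀ a b h → b ℤ.- (a ℤ.- h) ≡ (b ℤ.- a) ℤ.+ h
  shift = ℤ-Solver.solve-∀
... | -[1+ j ] = a ℤ.+ + h , trans (cong ∣_∣ (cancel a (+ h))) (ℤ.∣-i∣≡∣i∣ (+ h))
                           , trans (cong ∣_∣ (trans (shift a b (+ h))
                               (trans (cong (ℤ._- + h) eq) (negate (+ j) (+ h)))))
                               (ℤ.∣-i∣≡∣i∣ (+ suc (j + h)))
  where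
  cancel : ∀ a h → a ℤ.- (a ℤ.+ h) ≡ ℤ.- h
  cancel = ℤ-Solver.solve-∀
  shift : ∀ a b h → b ℤ.- (a ℤ.+ h) ≡ (b ℤ.- a) ℤ.- h
  shift = ℤ-Solver.solve-∀
  negate : ∀ j h → ℤ.- (+ 1 ℤ.+ j) ℤ.- h ≡ ℤ.- (+ 1 ℤ.+ (j ℤ.+ h))
  negate = ℤ-Solver.solve-∀

module Lattice (T : ℕ) .⦃ _ : NonZero T ⦄ where

  Multiple : ℤ → Set
  Multiple z = + T ℤ.∣ z

  floor : ∀ a → ∃[ x ] ∃[ s ] Multiple x × a ≡ + s ℤ.+ x × s < T
  floor a = (a ℤ./ℕ T) ℤ.* + T , a ℤ.%ℕ T , divides (a ℤ./ℕ T) refl ,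
            ℤ.a≡a%ℕn+[a/ℕn]*n a T , ℤ.n%ℕd<d a T

  Multiple-+T : ∀ {x} → Multiple x → Multiple (x ℤ.+ + T)
  Multiple-+T T∣x = ℤ.∣m∣n⇒∣m+n T∣x ℤ.∣-refl

  above-floor : ∀ s x → (+ s ℤ.+ x) ℤ.- (x ℤ.+ + T) ≡ s ℤ.⊖ T
  above-floor s x = trans (cancel (+ s) x (+ T)) (ℤ.m-n≡m⊖n s T)
    where
    cancel : ∀ s x t → (s ℤ.+ x) ℤ.- (x ℤ.+ t) ≡ s ℤ.- t
    cancel = ℤ-Solver.solve-∀

  below-floor : ∀ s x → (+ s ℤ.+ x) ℤ.- x ≡ + s
  below-floor s x = cancel (+ s) x
    where
    cancel : ∀ s x → (s ℤ.+ x) ℤ.- x ≡ s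
    cancel = ℤ-Solver.solve-∀

  nearest : ∀ a → ∃[ x ] Multiple x × 2 * ∣ a ℤ.- x ∣ ≤ T
  nearest a with floor a
  ... | x , s , T∣x , refl , s<T with 2 * s ℕ.≤? T
  ...   | yes 2s≤T = x , T∣x , subst (λ i → 2 * ∣ i ∣ ≤ T) (sym (below-floor s x)) 2s≤T
  ...   | no  2s≰T = x ℤ.+ + T , Multiple-+T T∣x , (begin
    2 * ∣ (+ s ℤ.+ x) ℤ.- (x ℤ.+ + T) ∣  ≡⟨ cong (λ i → 2 * ∣ i ∣) (above-floor s x) ⟩
    2 * ∣ s ℤ.⊖ T ∣                      ≡⟨ cong (2 *_) (ℤ.∣⊖∣-< s<T) ⟩
    2 * (T ∸ s)                          ≡⟨ ℕ.*-distribˡ-∸ 2 T s ⟩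
    2 * T ∸ 2 * s                        ≤⟨ ℕ.∸-monoʳ-≤ (2 * T) (ℕ.<⇒≤ (ℕ.≰⇒> 2s≰T)) ⟩
    2 * T ∸ T                            ≡⟨ ℕ.m+n∸m≡n T (T + 0) ⟩
    T + 0                                ≡⟨ ℕ.+-identityʳ T ⟩
    T                                    ∎)
    where open ≤-Reasoning

  nearestVec : ∀ {m} (u : Vec ℤ m) → ∃[ x ] All Multiple x × 2 * ‖ u - x ‖₁ ≤ m * T
  nearestVec []      = [] , [] , z≤n
  nearestVec {suc m} (a ∷ u) =
    let x , T∣x , ax = nearest a
        y , T∣y , uy = nearestVec u
    in x ∷ y , T∣x ∷ T∣y ,
       subst (_≤ suc m * T) (sym (ℕ.*-distribˡ-+ 2 ∣ a ℤ.- x ∣ ‖ u - y ‖₁)) (ℕ.+-mono-≤ ax uy)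

  -- Rearranged, `gap` says that ‖v - x‖ - ‖u - x‖ is larger at x₁ than at x₂, whereas equal code
  -- neighbourhoods force it to be the same on all lines that the ball of u meets. R bounds twice
  -- the distance, which avoids halving T.
  record Witness (R : ℕ) {m} (u v : Vec ℤ m) : Set where
    field
      x₁ x₂ : Vec ℤ m
      T∣x₁  : All Multiple x₁
      T∣x₂  : All Multiple x₂
      near₁ : 2 * ‖ u - x₁ ‖₁ ≤ R
      near₂ : 2 * ‖ u - x₂ ‖₁ ≤ R
      gap   : ‖ u - x₁ ‖₁ + ‖ v - x₂ ‖₁ < ‖ v - x₁ ‖₁ + ‖ u - x₂ ‖₁

  -- x₁ ≤ a < x₂ = x₁ + T: raising a to b moves away from x₁ by the full
  -- b − a, but not from x₂.
  witness-head : ∀ {m} a j (u v : Vec ℤ m) →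
                 Witness ((2 + m) * T) (a ∷ u) (a ℤ.+ + suc j ∷ v)
  witness-head {m} a j u v with floor a | nearestVec u
  ... | x , s , T∣x , refl , s<T | y , T∣y , uy = record
    { x₁ = x ∷ y ; x₂ = (x ℤ.+ + T) ∷ y
    ; T∣x₁ = T∣x ∷ T∣y ; T∣x₂ = Multiple-+T T∣x ∷ T∣y
    ; near₁ = near (subst (_≤ T) (sym a-x) (ℕ.<⇒≤ s<T))
    ; near₂ = near (subst (_≤ T) (sym a-x′) (ℕ.m∸n≤m T s))
    ; gap   = begin-strict
        (∣ a ℤ.- x ∣ + ‖ u - y ‖₁) + (∣ b ℤ.- x′ ∣ + ‖ v - y ‖₁)
          ≡⟨ cong (λ i → (i + ‖ u - y ‖₁) + (∣ b ℤ.- x′ ∣ + ‖ v - y ‖₁)) a-x ⟩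
        (s + ‖ u - y ‖₁) + (∣ b ℤ.- x′ ∣ + ‖ v - y ‖₁)
          <⟨ ℕ.+-monoʳ-< (s + ‖ u - y ‖₁) (ℕ.+-monoˡ-< ‖ v - y ‖₁ b-x′) ⟩
        (s + ‖ u - y ‖₁) + ((suc j + (T ∸ s)) + ‖ v - y ‖₁)
          ≡⟨ regroup s ‖ u - y ‖₁ (suc j) (T ∸ s) ‖ v - y ‖₁ ⟩
        ((s + suc j) + ‖ v - y ‖₁) + ((T ∸ s) + ‖ u - y ‖₁)
          ≡⟨ cong₂ (λ p q → (p + ‖ v - y ‖₁) + (q + ‖ u - y ‖₁)) b-x a-x′ ⟨
        (∣ b ℤ.- x ∣ + ‖ v - y ‖₁) + (∣ a ℤ.- x′ ∣ + ‖ u - y ‖₁) ∎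
    }
    where
    open ≤-Reasoning
    b x′ : ℤ
    b  = a ℤ.+ + suc j
    x′ = x ℤ.+ + T
    regroup : ∀ s p j t q → (s + p) + ((j + t) + q) ≡ ((s + j) + q) + (t + p)
    regroup = ℕ-Solver.solve-∀
    swap : ∀ s x j → (s ℤ.+ x) ℤ.+ j ≡ (s ℤ.+ j) ℤ.+ x
    swap = ℤ-Solver.solve-∀
    -- The head coordinate is allowed a distance of up to T, where rounding would give T/2; this is
    -- why R has one T more than the dimension.
    near : ∀ {c} → ∣ a ℤ.- c ∣ ≤ T → 2 * (∣ a ℤ.- c ∣ + ‖ u - y ‖₁) ≤ (2 + m) * T
    near {c} ac = begin
      2 * (∣ a ℤ.- c ∣ + ‖ u - y ‖₁)      ≡⟨ ℕ.*-distribˡ-+ 2 ∣ a ℤ.- c ∣ ‖ u - y ‖₁ ⟩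
      2 * ∣ a ℤ.- c ∣ + 2 * ‖ u - y ‖₁    ≤⟨ ℕ.+-mono-≤ (ℕ.*-monoʳ-≤ 2 ac) uy ⟩
      2 * T + m * T                       ≡⟨ ℕ.*-distribʳ-+ T 2 m ⟨
      (2 + m) * T                         ∎
    a-x : ∣ a ℤ.- x ∣ ≡ s
    a-x = cong ∣_∣ (below-floor s x)
    a-x′ : ∣ a ℤ.- x′ ∣ ≡ T ∸ s
    a-x′ = trans (cong ∣_∣ (above-floor s x)) (ℤ.∣⊖∣-< s<T)
    b-x : ∣ b ℤ.- x ∣ ≡ s + suc j
    b-x = cong ∣_∣ (trans (cong (ℤ._- x) (swap (+ s) x (+ suc j))) (below-floor (s + suc j) x))
    b-x′ : ∣ b ℤ.- x′ ∣ < suc j + (T ∸ s)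
    b-x′ with T ∸ s | ℕ.m<n⇒0<n∸m s<T | ℕ.m+[n∸m]≡n (ℕ.<⇒≤ s<T)
    -- From s < T the distance T - s is a positive `suc t`, and b - x′ is (j + 1) - (t + 1).
    ... | suc t | _ | s+t≡T = subst (λ i → ∣ i ∣ < suc j + suc t) (sym eq) (∣⊖∣<+ j t)
      where
      eq : b ℤ.- x′ ≡ suc j ℤ.⊖ suc t
      eq = ≡-Reasoning.begin
        b ℤ.- x′                       ≡-Reasoning.≡⟨ cong (ℤ._- x′) (swap (+ s) x (+ suc j)) ⟩
        (+ (s + suc j) ℤ.+ x) ℤ.- x′   ≡-Reasoning.≡⟨ above-floor (s + suc j) x ⟩
        (s + suc j) ℤ.⊖ T              ≡-Reasoning.≡⟨ cong ((s + suc j) ℤ.⊖_) s+t≡T ⟨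
        (s + suc j) ℤ.⊖ (s + suc t)    ≡-Reasoning.≡⟨ ℤ.+-cancelˡ-⊖ s (suc j) (suc t) ⟩
        suc j ℤ.⊖ suc t                ≡-Reasoning.∎

  -- The same multiple x heads both lines, so the first coordinate adds equally to both sides of
  -- `gap`; being nearest to a, it adds at most T to the doubled distances.
  witness-tail : ∀ {m} a (u v : Vec ℤ m) →
                 Witness (suc m * T) u v → Witness ((2 + m) * T) (a ∷ u) (a ∷ v)
  witness-tail {m} a u v W with nearest a
  ... | x , T∣x , ax = record
    { x₁ = x ∷ x₁ ; x₂ = x ∷ x₂ ; T∣x₁ = T∣x ∷ T∣x₁ ; T∣x₂ = T∣x ∷ T∣x₂
    ; near₁ = near x₁ near₁ ; near₂ = near x₂ near₂
    ; gap = subst₂ _<_ (interchange d ‖ u - x₁ ‖₁ ‖ v - x₂ ‖₁) (interchange d ‖ v - x₁ ‖₁ ‖ u - x₂ ‖₁)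
                   (ℕ.+-monoʳ-< (d + d) gap)
    }
    where
    open Witness W
    d : ℕ
    d = ∣ a ℤ.- x ∣
    near : ∀ y → 2 * ‖ u - y ‖₁ ≤ suc m * T → 2 * (d + ‖ u - y ‖₁) ≤ (2 + m) * T
    near y uy = subst (_≤ (2 + m) * T) (sym (ℕ.*-distribˡ-+ 2 d ‖ u - y ‖₁)) (ℕ.+-mono-≤ ax uy)
    interchange : ∀ d p q → (d + d) + (p + q) ≡ (d + p) + (d + q)
    interchange = ℕ-Solver.solve-∀

  -- Induction down to the first coordinate where u and v differ. `witness-head` wants the vector
  -- that is smaller there in the role of u, hence the disjunction.
  witness : ∀ {m} (u v : Vec ℤ m) → u ≢ v → Witness (suc m * T) u v ⊎ Witness (suc m * T) v u
  witness []      []      u≢v = contradiction refl u≢v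
  witness (a ∷ u) (b ∷ v) u≢v with compareℤ a b
  ... | inj₂ (inj₁ (j , refl)) = inj₁ (witness-head a j u v)
  ... | inj₂ (inj₂ (j , refl)) = inj₂ (witness-head b j v u)
  ... | inj₁ refl with witness u v (u≢v ∘ cong (a ∷_))
  ...   | inj₁ W = inj₁ (witness-tail a u v W)
  ...   | inj₂ W = inj₂ (witness-tail a v u W)

  code : ∀ m → Code (L (suc m))
  code m = record
    { Member   = λ u → All Multiple (tail u) × + 2 ℤ.∣ total u
    ; member?  = λ u → All.all? (+ T ℤ.∣?_) (tail u) ×-dec (+ 2 ℤ.∣? total u)
    ; nonempty = + 0 ∷ replicate m (+ 0) , multiples m , divides (+ 0) (cong (λ i → + 0 ℤ.+ i) (total-0 m))
    }
    where
    multiples : ∀ m → All Multiple (replicate m (+ 0))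
    multiples zero    = []
    multiples (suc m) = divides (+ 0) refl ∷ multiples m
    total-0 : ∀ m → total (replicate m (+ 0)) ≡ + 0
    total-0 zero    = refl
    total-0 (suc m) = cong (λ i → + 0 ℤ.+ i) (total-0 m)

  -- The code is identifying

  module _ {m r} (radius : ∀ s → EffectiveRadius r s) (wide : (3 + m) * T ≤ 2 * r) where

    open Code (code m)

    rad : Vec ℤ (suc m) → ℕ
    rad u = EffectiveRadius.ρ (radius (total u))

    rad≤r : ∀ u → rad u ≤ r
    rad≤r u = EffectiveRadius.ρ≤r (radius (total u))

    dist≤rad : ∀ v {c} → Member c → ‖ v - c ‖₁ ≤ r → ‖ v - c ‖₁ ≤ rad v
    dist≤rad v {c} (_ , 2∣c) vc = EffectiveRadius.maximal (radius (total v)) vc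
      (subst (+ 2 ℤ.∣_) (cancel (+ ‖ v - c ‖₁) (total v) (total c))
        (ℤ.∣m∣n⇒∣m-n (‖-‖₁-parity v c) 2∣c))
      where
      cancel : ∀ d s t → (d ℤ.- (s ℤ.- t)) ℤ.- t ≡ d ℤ.- s
      cancel = ℤ-Solver.solve-∀

    -- By `wide`, a distance of at most (m + 1)T/2 is at most r - T, and T ≥ 1 absorbs the unit that
    -- parity may cost.
    near⇒≤rad : ∀ u {d} → 2 * d ≤ suc m * T → d ≤ rad u
    near⇒≤rad u {d} near = ℕ.s≤s⁻¹ (ℕ.≤-trans
      (ℕ.*-cancelˡ-≤ 2 (begin
        2 * suc d            ≡⟨ ℕ.*-distribˡ-+ 2 1 d ⟩
        2 * 1 + 2 * d        ≤⟨ ℕ.+-mono-≤ (ℕ.*-monoʳ-≤ 2 (ℕ.>-nonZero⁻¹ T)) near ⟩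
        2 * T + suc m * T    ≡⟨ ℕ.*-distribʳ-+ T 2 (suc m) ⟨
        (3 + m) * T          ≤⟨ wide ⟩
        2 * r                ∎))
      (EffectiveRadius.r≤1+ρ (radius (total u))))
      where open ≤-Reasoning

    -- `w ∷ x` is the extreme point of the ball on the line x, on the side away from b. Its distance
    -- from `a ∷ u` is exactly `rad (a ∷ u)`, and the parity of that radius forces an even
    -- coordinate sum.
    codeword : ∀ a u x b → All Multiple x → ‖ u - x ‖₁ ≤ rad (a ∷ u) →
               ∃[ w ] Member (w ∷ x) × ‖ a ∷ u - w ∷ x ‖₁ ≡ rad (a ∷ u) ×
                      ∣ b ℤ.- w ∣ ≡ ∣ b ℤ.- a ∣ + (rad (a ∷ u) ∸ ‖ u - x ‖₁)
    codeword a u x b T∣x ux with extend a b (rad (a ∷ u) ∸ ‖ u - x ‖₁)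
    ... | w , aw , bw = w , (T∣x , even) , dist , bw
      where
      dist : ‖ a ∷ u - w ∷ x ‖₁ ≡ rad (a ∷ u)
      dist = trans (cong (_+ ‖ u - x ‖₁) aw) (ℕ.m∸n+n≡m ux)
      cancel : ∀ d s t → (d ℤ.- (s ℤ.- t)) ℤ.- (d ℤ.- s) ≡ t
      cancel = ℤ-Solver.solve-∀
      even : + 2 ℤ.∣ total (w ∷ x)
      even = subst (+ 2 ℤ.∣_) (cancel (+ rad (a ∷ u)) (total (a ∷ u)) (total (w ∷ x)))
        (ℤ.∣m∣n⇒∣m-n
          (subst (λ d → + 2 ℤ.∣ + d ℤ.- (total (a ∷ u) ℤ.- total (w ∷ x))) dist
            (‖-‖₁-parity (a ∷ u) (w ∷ x)))
          (EffectiveRadius.parity (radius (total (a ∷ u)))))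

    -- The point given by `codeword` also lies in the ball of `b ∷ v`, so its distance from there,
    -- |b - a| + (rad (a ∷ u) - ‖u - x‖) + ‖v - x‖, is at most `rad (b ∷ v)`.
    transfer : ∀ {a u b v} → Ball (L (suc m)) r (a ∷ u) ∩ Member ⊆ Ball (L (suc m)) r (b ∷ v) →
               ∀ {x} → All Multiple x → ‖ u - x ‖₁ ≤ rad (a ∷ u) →
               rad (a ∷ u) + (∣ b ℤ.- a ∣ + ‖ v - x ‖₁) ≤ rad (b ∷ v) + ‖ u - x ‖₁
    transfer {a} {u} {b} {v} B⊆B {x} T∣x ux with codeword a u x b T∣x ux
    ... | w , c∈C , uc , bw = begin
      rad (a ∷ u) + (g + ‖ v - x ‖₁)
        ≡⟨ cong (_+ (g + ‖ v - x ‖₁)) (ℕ.m∸n+n≡m ux) ⟨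
      (h + ‖ u - x ‖₁) + (g + ‖ v - x ‖₁)
        ≡⟨ regroup h ‖ u - x ‖₁ g ‖ v - x ‖₁ ⟩
      ((g + h) + ‖ v - x ‖₁) + ‖ u - x ‖₁
        ≡⟨ cong (λ i → (i + ‖ v - x ‖₁) + ‖ u - x ‖₁) bw ⟨
      ‖ b ∷ v - w ∷ x ‖₁ + ‖ u - x ‖₁
        ≤⟨ ℕ.+-monoˡ-≤ ‖ u - x ‖₁ (dist≤rad (b ∷ v) c∈C
             (ball⁻ (B⊆B (ball⁺ (ℕ.≤-trans (ℕ.≤-reflexive uc) (rad≤r (a ∷ u))) , c∈C)))) ⟩
      rad (b ∷ v) + ‖ u - x ‖₁ ∎
      where
      open ≤-Reasoning
      g h : ℕ
      g = ∣ b ℤ.- a ∣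
      h = rad (a ∷ u) ∸ ‖ u - x ‖₁
      regroup : ∀ h p g q → (h + p) + (g + q) ≡ ((g + h) + q) + p
      regroup = ℕ-Solver.solve-∀

    covers : ∀ v → Satisfiable (Ball (L (suc m)) r v ∩ Member)
    covers (a ∷ u) with nearestVec u
    ... | x , T∣x , ux with codeword a u x a T∣x (near⇒≤rad (a ∷ u) (ℕ.≤-trans ux (ℕ.m≤n+m (m * T) T)))
    ...   | w , c∈C , uc , _ = w ∷ x , ball⁺ (ℕ.≤-trans (ℕ.≤-reflexive uc) (rad≤r (a ∷ u))) , c∈C

    -- Adding the transfer inequality from u to v at x₁ to the one from v
    -- to u at x₂ eliminates both effective radii.
    no-gap : ∀ {a u b v x₁ x₂} →
             Ball (L (suc m)) r (a ∷ u) ∩ Member ⊆ Ball (L (suc m)) r (b ∷ v) →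
             Ball (L (suc m)) r (b ∷ v) ∩ Member ⊆ Ball (L (suc m)) r (a ∷ u) →
             All Multiple x₁ → All Multiple x₂ →
             2 * ‖ u - x₁ ‖₁ ≤ suc m * T → 2 * ‖ u - x₂ ‖₁ ≤ suc m * T →
             (∣ b ℤ.- a ∣ + ‖ v - x₁ ‖₁) + ‖ u - x₂ ‖₁ ≤ ‖ u - x₁ ‖₁ + ‖ v - x₂ ‖₁
    no-gap {a} {u} {b} {v} {x₁} {x₂} u⊆v v⊆u T∣x₁ T∣x₂ near₁ near₂ =
      ℕ.+-cancelˡ-≤ (ρᵤ + ρᵥ) _ _ (begin
        (ρᵤ + ρᵥ) + ((g + ‖ v - x₁ ‖₁) + ‖ u - x₂ ‖₁)
          ≡⟨ interchange ρᵤ ρᵥ (g + ‖ v - x₁ ‖₁) ‖ u - x₂ ‖₁ ⟩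
        (ρᵤ + (g + ‖ v - x₁ ‖₁)) + (ρᵥ + ‖ u - x₂ ‖₁)
          ≤⟨ ℕ.+-mono-≤ (transfer u⊆v T∣x₁ (near⇒≤rad (a ∷ u) near₁))
                        (ℕ.+-monoʳ-≤ ρᵥ (ℕ.m≤n+m ‖ u - x₂ ‖₁ ∣ a ℤ.- b ∣)) ⟩
        (ρᵥ + ‖ u - x₁ ‖₁) + (ρᵥ + (∣ a ℤ.- b ∣ + ‖ u - x₂ ‖₁))
          ≤⟨ ℕ.+-monoʳ-≤ (ρᵥ + ‖ u - x₁ ‖₁) (transfer v⊆u T∣x₂ vx₂) ⟩
        (ρᵥ + ‖ u - x₁ ‖₁) + (ρᵤ + ‖ v - x₂ ‖₁)
          ≡⟨ regroup ρᵥ ‖ u - x₁ ‖₁ ρᵤ ‖ v - x₂ ‖₁ ⟩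
        (ρᵤ + ρᵥ) + (‖ u - x₁ ‖₁ + ‖ v - x₂ ‖₁) ∎)
      where
      open ≤-Reasoning
      ρᵤ ρᵥ g : ℕ
      ρᵤ = rad (a ∷ u)
      ρᵥ = rad (b ∷ v)
      g  = ∣ b ℤ.- a ∣
      interchange : ∀ p q s t → (p + q) + (s + t) ≡ (p + s) + (q + t)
      interchange = ℕ-Solver.solve-∀
      regroup : ∀ p s q t → (p + s) + (q + t) ≡ (q + p) + (s + t)
      regroup = ℕ-Solver.solve-∀
      -- Before `transfer` applies from v to u, the ball of v must reach the line x₂. The ball of u
      -- does, so `transfer` from u to v bounds ‖v - x₂‖ by ρᵥ + ‖u - x₂‖ - ρᵤ ≤ ρᵥ.
      vx₂ : ‖ v - x₂ ‖₁ ≤ ρᵥ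
      vx₂ = ℕ.+-cancelˡ-≤ ρᵤ _ _ (begin
        ρᵤ + ‖ v - x₂ ‖₁        ≤⟨ ℕ.+-monoʳ-≤ ρᵤ (ℕ.m≤n+m ‖ v - x₂ ‖₁ g) ⟩
        ρᵤ + (g + ‖ v - x₂ ‖₁)  ≤⟨ transfer u⊆v T∣x₂ (near⇒≤rad (a ∷ u) near₂) ⟩
        ρᵥ + ‖ u - x₂ ‖₁        ≤⟨ ℕ.+-monoʳ-≤ ρᵥ (near⇒≤rad (a ∷ u) near₂) ⟩
        ρᵥ + ρᵤ                 ≡⟨ ℕ.+-comm ρᵥ ρᵤ ⟩
        ρᵤ + ρᵥ                 ∎)

    -- Taking the same line for x₁ and x₂ in `no-gap` cancels all distances except |b - a|.
    equal-heads : ∀ {a u b v} →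
                  Ball (L (suc m)) r (a ∷ u) ∩ Member ⊆ Ball (L (suc m)) r (b ∷ v) →
                  Ball (L (suc m)) r (b ∷ v) ∩ Member ⊆ Ball (L (suc m)) r (a ∷ u) →
                  b ≡ a
    equal-heads {a} {u} {b} {v} u⊆v v⊆u with nearestVec u
    ... | x , T∣x , ux = ℤ.i-j≡0⇒i≡j b a (ℤ.∣i∣≡0⇒i≡0 (ℕ.n≤0⇒n≡0
      (ℕ.+-cancelʳ-≤ (‖ u - x ‖₁ + ‖ v - x ‖₁) _ _
        (subst (_≤ ‖ u - x ‖₁ + ‖ v - x ‖₁) (regroup ∣ b ℤ.- a ∣ ‖ v - x ‖₁ ‖ u - x ‖₁)
          (no-gap u⊆v v⊆u T∣x T∣x near near)))))
      where
      near : 2 * ‖ u - x ‖₁ ≤ suc m * T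
      near = ℕ.≤-trans ux (ℕ.m≤n+m (m * T) T)
      regroup : ∀ g p q → (g + p) + q ≡ g + (q + p)
      regroup = ℕ-Solver.solve-∀

    no-witness : ∀ {a u b v} →
                 Ball (L (suc m)) r (a ∷ u) ∩ Member ⊆ Ball (L (suc m)) r (b ∷ v) →
                 Ball (L (suc m)) r (b ∷ v) ∩ Member ⊆ Ball (L (suc m)) r (a ∷ u) →
                 ¬ Witness (suc m * T) u v
    no-witness {a} {u} {b} {v} u⊆v v⊆u W = ℕ.<⇒≱ gap (ℕ.≤-trans
      (ℕ.+-monoˡ-≤ ‖ u - x₂ ‖₁ (ℕ.m≤n+m ‖ v - x₁ ‖₁ ∣ b ℤ.- a ∣))
      (no-gap u⊆v v⊆u T∣x₁ T∣x₂ near₁ near₂))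
      where open Witness W

    separates : ∀ {a u b v} →
                Ball (L (suc m)) r (a ∷ u) ∩ Member ⊆ Ball (L (suc m)) r (b ∷ v) →
                Ball (L (suc m)) r (b ∷ v) ∩ Member ⊆ Ball (L (suc m)) r (a ∷ u) →
                b ≡ a → ¬ (a ∷ u ≢ b ∷ v)
    separates {a} {u} {b} {v} u⊆v v⊆u refl u≢v =
      [ no-witness {a} {u} {b} {v} u⊆v v⊆u , no-witness {b} {v} {a} {u} v⊆u u⊆v ]′
        (witness u v (λ u≡v → u≢v (cong (a ∷_) u≡v)))

    identifying : IsIdentifying (L (suc m)) r (code m)
    identifying = record
      { covering   = covers
      ; separating = λ { {a ∷ u} {b ∷ v} u≢v (u⊆v , v⊆u) →
          let u⊆v′ : Ball (L (suc m)) r (a ∷ u) ∩ Member ⊆ Ball (L (suc m)) r (b ∷ v)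
              u⊆v′ c = proj₁ (u⊆v c)
              v⊆u′ : Ball (L (suc m)) r (b ∷ v) ∩ Member ⊆ Ball (L (suc m)) r (a ∷ u)
              v⊆u′ c = proj₁ (v⊆u c)
          in separates {a} {u} {b} {v} u⊆v′ v⊆u′ (equal-heads {a} {u} {b} {v} u⊆v′ v⊆u′) u≢v }
      }

-- Density

unique-⊆⇒length≤ : ∀ {A : Set} {xs ys : List A} → Unique xs → xs ⊆ᴸ ys → length xs ≤ length ys
unique-⊆⇒length≤ {xs = []}     _          _  = z≤n
unique-⊆⇒length≤ {xs = x ∷ xs} {ys} (x∉xs ∷ xs!) xs⊆ys = begin
  suc (length xs)         ≤⟨ s≤s (unique-⊆⇒length≤ xs! xs⊆ys─x) ⟩
  suc (length (ys ─ x∈))  ≡⟨ List.length-removeAt′ ys (index x∈) ⟨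
  length ys               ∎
  where
  open ≤-Reasoning
  x∈ : x ∈ ys
  x∈ = xs⊆ys (here refl)
  remove : ∀ {zs} {y : _} (p : x ∈ zs) → y ∈ zs → x ≢ y → y ∈ (zs ─ p)
  remove (here refl) (here refl) x≢y = contradiction refl x≢y
  remove (here refl) (there q)   x≢y = q
  remove (there p)   (here refl) x≢y = here refl
  remove (there p)   (there q)   x≢y = there (remove p q x≢y)
  xs⊆ys─x : xs ⊆ᴸ (ys ─ x∈)
  xs⊆ys─x y∈ = remove x∈ (xs⊆ys (there y∈)) (ListAll.lookup x∉xs y∈)

length-cartesianProductWith : ∀ {A B C : Set} (f : A → B → C) xs ys →
  length (cartesianProductWith f xs ys) ≡ length xs * length ys
length-cartesianProductWith f []       ys = refl
length-cartesianProductWith f (x ∷ xs) ys = trans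
  (List.length-++ (List.map (f x) ys))
  (cong₂ _+_ (List.length-map (f x) ys) (length-cartesianProductWith f xs ys))

length-interval : ∀ M → length (interval M) ≡ suc M + M
length-interval M = trans (List.length-++ (List.map +_ (upTo (suc M)))) (cong₂ _+_
  (trans (List.length-map +_ (upTo (suc M))) (List.length-upTo (suc M)))
  (trans (List.length-map -[1+_] (upTo M)) (List.length-upTo M)))

length-Q : ∀ n M → length (Q n M) ≡ (suc M + M) ^ n
length-Q zero    M = refl
length-Q (suc n) M = trans (length-cartesianProductWith _∷_ (interval M) (Q n M))
  (cong₂ _*_ (length-interval M) (length-Q n M))

-- (1 + c/N)ⁿ ≤ 1 + K/N for N ≥ 1, with K = (1 + c)ⁿ − 1.
excess : ℕ → ℕ → ℕ
excess c zero    = 0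
excess c (suc n) = (excess c n + c) + excess c n * c

^-excess : ∀ c n N .⦃ _ : NonZero N ⦄ → (N + c) ^ n * N ≤ N ^ n * (N + excess c n)
^-excess c zero    N = ℕ.≤-reflexive (cong (_+ 0) (sym (ℕ.+-identityʳ N)))
^-excess c (suc n) N@(suc N-1) = begin
  (N + c) * (N + c) ^ n * N      ≡⟨ ℕ.*-assoc (N + c) ((N + c) ^ n) N ⟩
  (N + c) * ((N + c) ^ n * N)    ≤⟨ ℕ.*-monoʳ-≤ (N + c) (^-excess c n N) ⟩
  (N + c) * (N ^ n * (N + K))    ≡⟨ swap (N + c) (N ^ n) (N + K) ⟩
  -- Multiplied out, (N + c)(N + K) and N(N + K′) differ only in Kc against NKc, and N ≥ 1.
  N ^ n * ((N + c) * (N + K))    ≤⟨ ℕ.*-monoʳ-≤ (N ^ n) (ℕ.≤-trans (ℕ.m≤m+n ((N + c) * (N + K)) (N-1 * (K * c))) (ℕ.≤-reflexive (expand N-1 c K))) ⟩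
  N ^ n * (N * (N + K′))         ≡⟨ assoc (N ^ n) N (N + K′) ⟩
  N * N ^ n * (N + K′)           ∎
  where
  open ≤-Reasoning
  K K′ : ℕ
  K  = excess c n
  K′ = excess c (suc n)
  swap : ∀ a b d → a * (b * d) ≡ b * (a * d)
  swap = ℕ-Solver.solve-∀
  assoc : ∀ a b d → a * (b * d) ≡ b * a * d
  assoc = ℕ-Solver.solve-∀
  expand : ∀ N c K → (1 + N + c) * (1 + N + K) + N * (K * c) ≡ (1 + N) * (1 + N + ((K + c) + K * c))
  expand = ℕ-Solver.solve-∀

*-^-distribʳ : ∀ a b n → (a * b) ^ n ≡ a ^ n * b ^ n
*-^-distribʳ a b zero    = refl
*-^-distribʳ a b (suc n) = trans (cong (a * b *_) (*-^-distribʳ a b n)) (interchange a b (a ^ n) (b ^ n))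
  where
  interchange : ∀ a b c d → a * b * (c * d) ≡ a * c * (b * d)
  interchange = ℕ-Solver.solve-∀

-- Rational bounds on a density

÷-<⁺ : ∀ c d .⦃ _ : NonZero d ⦄ p → + c ℤ.* ℚ.↧ p ℤ.< ℚ.↥ p ℤ.* + d → (+ c ÷ d) ℚ.< p
÷-<⁺ c (suc d) p@record{} ineq = ℚ.toℚᵘ-cancel-<
  (ℚᵘ.<-respˡ-≃ (ℚᵘ.≃-sym (ℚ.toℚᵘ-fromℚᵘ (mkℚᵘ (+ c) d))) (ℚᵘ.*<* ineq))

÷-<⁻ : ∀ c d .⦃ _ : NonZero d ⦄ p → (+ c ÷ d) ℚ.< p → + c ℤ.* ℚ.↧ p ℤ.< ℚ.↥ p ℤ.* + d
÷-<⁻ c (suc d) p@record{} c/d<p = ℚᵘ.drop-*<*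
  (ℚᵘ.<-respˡ-≃ (ℚ.toℚᵘ-fromℚᵘ (mkℚᵘ (+ c) d)) (ℚ.toℚᵘ-mono-< c/d<p))

÷-<⁻-negative : ∀ c d .⦃ _ : NonZero d ⦄ P D → ¬ (+ c ℤ.* + suc D ℤ.< -[1+ P ] ℤ.* + d)
÷-<⁻-negative c (suc d) P D lt with + c ℤ.* + suc D | ℤ.pos-* c (suc D)
÷-<⁻-negative c (suc d) P D () | _ | refl

-- The limsup is reduced to inequalities between natural numbers. An intermediate p supplies the
-- uniform bound strictly below q that `⨆` asks for; a negative p cannot exceed c/d.
density-≤-fraction : ∀ {n} (C : Code (L n)) c d .⦃ _ : NonZero d ⦄ →
  (∀ P D → c * D < P * d → ∃[ M ] ∀ j →
    length (filter (Code.member? C) (Q n (M + j))) * D < P * length (Q n (M + j))) →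
  density C ≤ᵘ fromℚ (+ c ÷ d)
density-≤-fraction {n} C c d bound {q} c/d<q with p , c/d<p , p<q ← ℚ.<-dense c/d<q =
  let M , below = eventually p c/d<p in M , p , p<q , below
  where
  members : ℕ → ℕ
  members M = length (filter (Code.member? C) (Q n M))
  ratio : ℕ → ℚ
  ratio M = ((+ members M) ÷ length (Q n M)) ⦃ ∣Q∣≢0 n M ⦄
  eventually : ∀ p → (+ c ÷ d) ℚ.< p → ∃[ M ] ∀ j → ratio (M + j) ℚ.< p
  eventually p@(mkℚ (+ P) D-1 _) c/d<p =
    let M , below = bound P (suc D-1) (ℤ.drop‿+<+ (subst₂ ℤ._<_
          (sym (ℤ.pos-* c (suc D-1))) (sym (ℤ.pos-* P d)) (÷-<⁻ c d p c/d<p)))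
    in M , λ j → ÷-<⁺ (members (M + j)) (length (Q n (M + j))) ⦃ ∣Q∣≢0 n (M + j) ⦄ p
         (subst₂ ℤ._<_ (ℤ.pos-* (members (M + j)) (suc D-1)) (ℤ.pos-* P (length (Q n (M + j)))) (ℤ.+<+ (below j)))
  eventually p@(mkℚ -[1+ P ] D-1 _) c/d<p = contradiction (÷-<⁻ c d p c/d<p) (÷-<⁻-negative c d P D-1)

-- Counting code vertices in a cube

∣w∣≤M⇒w+M : ∀ {w M} → ∣ w ∣ ≤ M → ∃[ k ] w ℤ.+ + M ≡ + k × k ≤ M + M
∣w∣≤M⇒w+M {+ a}      {M} a≤M = a + M , refl , ℕ.+-monoˡ-≤ M a≤M
∣w∣≤M⇒w+M { -[1+ a ]} {M} a<M = M ∸ suc a , ℤ.⊖-≥ a<M , ℕ.≤-trans (ℕ.m∸n≤m M (suc a)) (ℕ.m≤m+n M M)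

nonneg-half : ∀ i {k} → i ℤ.* + 2 ≡ + k → ∃[ j ] i ≡ + j × j * 2 ≡ k
nonneg-half (+ j) eq = j , refl , ℤ.+-injective (trans (ℤ.pos-* j 2) eq)

-- For j = 0, 1, … these are the w ≥ −M − s with w ∷ x of even sum, where
-- s ∈ {0, 1} is a remainder mod 2.
head-from : ℕ → ∀ {n} → Vec ℤ n → ℕ → ℤ
head-from M x j = ((total x ℤ.- + M) ℤ./ℕ 2 ℤ.+ + j) ℤ.* + 2 ℤ.- total x

-- Solving w = `head-from M x j` for j gives q - A/2 with floor division; twice this is the offset k
-- of w from -M plus the remainder of A.
double-offset : ∀ w X M q {k} → w ℤ.+ X ≡ q ℤ.* + 2 → w ℤ.+ + M ≡ + k →
  let A = X ℤ.- + M in (q ℤ.- A ℤ./ℕ 2) ℤ.* + 2 ≡ + (k + A ℤ.%ℕ 2)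
double-offset w X M q {k} w+x≡2q w+M≡k = begin
  (q ℤ.- f) ℤ.* + 2                                  ≡⟨ expand q f ⟩
  q ℤ.* + 2 ℤ.- f ℤ.* + 2                            ≡⟨ cong (ℤ._- f ℤ.* + 2) w+x≡2q ⟨
  (w ℤ.+ X) ℤ.- f ℤ.* + 2                            ≡⟨ regroup w X (+ M) (f ℤ.* + 2) ⟩
  (w ℤ.+ + M) ℤ.+ ((X ℤ.- + M) ℤ.- f ℤ.* + 2)        ≡⟨ cong₂ (λ a b → a ℤ.+ (b ℤ.- f ℤ.* + 2)) w+M≡k (ℤ.a≡a%ℕn+[a/ℕn]*n (X ℤ.- + M) 2) ⟩
  + k ℤ.+ ((+ s ℤ.+ f ℤ.* + 2) ℤ.- f ℤ.* + 2)        ≡⟨ cong (λ i → + k ℤ.+ i) (drop (+ s) (f ℤ.* + 2)) ⟩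
  + (k + s)                                          ∎
  where
  open ≡-Reasoning
  f : ℤ
  f = (X ℤ.- + M) ℤ./ℕ 2
  s : ℕ
  s = (X ℤ.- + M) ℤ.%ℕ 2
  expand : ∀ q f → (q ℤ.- f) ℤ.* + 2 ≡ q ℤ.* + 2 ℤ.- f ℤ.* + 2
  expand = ℤ-Solver.solve-∀
  regroup : ∀ w X M g → (w ℤ.+ X) ℤ.- g ≡ (w ℤ.+ M) ℤ.+ ((X ℤ.- M) ℤ.- g)
  regroup = ℤ-Solver.solve-∀
  drop : ∀ w X → (w ℤ.+ X) ℤ.- X ≡ w
  drop = ℤ-Solver.solve-∀

-- At most M + 1 heads occur, since 2j = k + s with k ≤ 2M and s ≤ 1.
head-index : ∀ {n} M (x : Vec ℤ n) w → + 2 ℤ.∣ total (w ∷ x) → ∣ w ∣ ≤ M →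
             ∃[ j ] j < suc M × w ≡ head-from M x j
head-index M x w (divides q w+x≡2q) w≤M
  with k , w+M≡k , k≤2M ← ∣w∣≤M⇒w+M {w} w≤M
  with j , q-f≡j , j*2≡k+s ← nonneg-half (q ℤ.- (total x ℤ.- + M) ℤ./ℕ 2) (double-offset w (total x) M q w+x≡2q w+M≡k)
  = j , ℕ.*-cancelʳ-< 2 j (suc M) (begin-strict
      j * 2          ≡⟨ j*2≡k+s ⟩
      k + s          <⟨ ℕ.+-mono-≤-< k≤2M (ℤ.n%ℕd<d (X ℤ.- + M) 2) ⟩
      M + M + 2      ≡⟨ twice M ⟩
      suc M * 2      ∎)
    , sym (trans (cong (λ i → (f ℤ.+ i) ℤ.* + 2 ℤ.- X) (sym q-f≡j))
           (trans (cancel f q X) (trans (cong (ℤ._- X) (sym w+x≡2q)) (drop w X))))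
  where
  open ≤-Reasoning
  X f : ℤ
  X = total x
  f = (X ℤ.- + M) ℤ./ℕ 2
  s : ℕ
  s = (X ℤ.- + M) ℤ.%ℕ 2
  twice : ∀ M → M + M + 2 ≡ (1 + M) * 2
  twice = ℕ-Solver.solve-∀
  cancel : ∀ f q X → (f ℤ.+ (q ℤ.- f)) ℤ.* + 2 ℤ.- X ≡ q ℤ.* + 2 ℤ.- X
  cancel = ℤ-Solver.solve-∀
  drop : ∀ w X → (w ℤ.+ X) ℤ.- X ≡ w
  drop = ℤ-Solver.solve-∀
module Density (T : ℕ) .⦃ _ : NonZero T ⦄ (m : ℕ) where

  open Lattice T
  open Code (code m)

  scale : ∀ {n} → Vec ℤ n → Vec ℤ n
  scale = Vec.map (ℤ._* + T)

  unscale : ∀ {n M} {x : Vec ℤ n} → All Multiple x → All (λ z → ∣ z ∣ ≤ M) x →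
            ∃[ z ] x ≡ scale z × All (λ z → ∣ z ∣ ≤ M / T) z
  unscale []                     []         = [] , refl , []
  unscale {M = M} (divides q refl ∷ T∣x) (qT≤M ∷ x≤M) with unscale T∣x x≤M
  ... | z , refl , z≤ = q ∷ z , refl , (begin
    ∣ q ∣                ≡⟨ ℕ.m*n/n≡m ∣ q ∣ T ⟨
    ∣ q ∣ * T / T        ≡⟨ cong (_/ T) (ℤ.abs-* q (+ T)) ⟨
    ∣ q ℤ.* + T ∣ / T    ≤⟨ ℕ./-monoˡ-≤ T qT≤M ⟩
    M / T                ∎) ∷ z≤
    where open ≤-Reasoning

  -- A superset of the code vertices in the cube; it may leave the cube, but its length is the
  -- product (M + 1)(2⌊M/T⌋ + 1)ᵐ.
  candidates : ℕ → List (Vec ℤ (suc m))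
  candidates M = cartesianProductWith (λ j z → head-from M (scale z) j ∷ scale z) (upTo (suc M)) (Q m (M / T))

  code⊆candidates : ∀ M → filter member? (Q (suc m) M) ⊆ᴸ candidates M
  code⊆candidates M {w ∷ x} u∈ =
    let u∈Q , T∣x , 2∣u = ∈-filter⁻ member? {xs = Q (suc m) M} u∈
        u≤M = Equivalence.to ∈-Q u∈Q
    in candidate (head-index M x w 2∣u (All.head u≤M)) (unscale T∣x (All.tail u≤M))
    where
    candidate : ∃[ j ] j < suc M × w ≡ head-from M x j →
                ∃[ z ] x ≡ scale z × All (λ z → ∣ z ∣ ≤ M / T) z →
                (w ∷ x) ∈ candidates M
    candidate (j , j≤M , refl) (z , refl , z≤) =
      ∈-cartesianProductWith⁺ (λ j z → head-from M (scale z) j ∷ scale z)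
        (∈-upTo⁺ j≤M) (Equivalence.from ∈-Q z≤)

  count : ℕ → ℕ
  count M = length (filter member? (Q (suc m) M))

  -- Each factor is compared with N + T, where N = 2M + 1: the heads by 2(M + 1) ≤ N + T, each tail
  -- coordinate by (2⌊M/T⌋ + 1)T ≤ N + T.
  count≤ : ∀ M → count M * (2 * T ^ m) ≤ (suc M + M + T) ^ suc m
  count≤ M = begin
    count M * (2 * T ^ m)
      ≤⟨ ℕ.*-monoˡ-≤ (2 * T ^ m) (unique-⊆⇒length≤ (Unique.filter⁺ member? (Q-unique (suc m) M)) (code⊆candidates M)) ⟩
    length (candidates M) * (2 * T ^ m)
      ≡⟨ cong (_* (2 * T ^ m)) (trans
           (length-cartesianProductWith (λ j z → head-from M (scale z) j ∷ scale z) (upTo (suc M)) (Q m k))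
           (cong₂ _*_ (List.length-upTo (suc M)) (length-Q m k))) ⟩
    suc M * (suc k + k) ^ m * (2 * T ^ m)
      ≡⟨ interchange (suc M) ((suc k + k) ^ m) 2 (T ^ m) ⟩
    (suc M * 2) * ((suc k + k) ^ m * T ^ m)
      ≡⟨ cong (suc M * 2 *_) (*-^-distribʳ (suc k + k) T m) ⟨
    (suc M * 2) * ((suc k + k) * T) ^ m
      ≤⟨ ℕ.*-mono-≤ heads (ℕ.^-monoˡ-≤ m tails) ⟩
    (suc M + M + T) ^ suc m ∎
    where
    open ≤-Reasoning
    k : ℕ
    k = M / T
    interchange : ∀ a b c d → a * b * (c * d) ≡ a * c * (b * d)
    interchange = ℕ-Solver.solve-∀
    twice : ∀ M → (1 + M) * 2 ≡ 1 + M + M + 1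
    twice = ℕ-Solver.solve-∀
    heads : suc M * 2 ≤ suc M + M + T
    heads = subst (_≤ suc M + M + T) (sym (twice M)) (ℕ.+-monoʳ-≤ (suc M + M) (ℕ.>-nonZero⁻¹ T))
    distrib : ∀ k T → (1 + k + k) * T ≡ k * T + k * T + T
    distrib = ℕ-Solver.solve-∀
    kT≤M : k * T ≤ M
    kT≤M = ℕ.m/n*n≤m M T
    tails : (suc k + k) * T ≤ suc M + M + T
    tails = subst (_≤ suc M + M + T) (sym (distrib k T))
      (ℕ.+-monoˡ-≤ T (ℕ.+-mono-≤ (ℕ.m≤n⇒m≤1+n kT≤M) kT≤M))

  K : ℕ
  K = excess T (suc m)

  -- With b = 2Tᵐ, n = m + 1 and N = 2M + 1, the count times b is at most (N + T)ⁿ ≤ Nⁿ(1 + K/N).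
  -- Integrality turns D < Pb into D + 1 ≤ Pb, and this unit outweighs the relative error K/N once
  -- KD < N.
  count< : ∀ P D M → D < P * (2 * T ^ m) → K * D < suc M + M → count M * D < P * length (Q (suc m) M)
  count< P D M D<Pb KD<N = subst (λ l → count M * D < P * l) (sym (length-Q (suc m) M))
    (ℕ.*-cancelʳ-< (b * N) (count M * D) (P * N ^ suc m) (begin-strict
      count M * D * (b * N)            ≡⟨ regroup₁ (count M) D b N ⟩
      count M * b * (N * D)            ≤⟨ ℕ.*-monoˡ-≤ (N * D) (count≤ M) ⟩
      (N + T) ^ suc m * (N * D)        ≡⟨ ℕ.*-assoc ((N + T) ^ suc m) N D ⟨
      (N + T) ^ suc m * N * D          ≤⟨ ℕ.*-monoˡ-≤ D (^-excess T (suc m) N) ⟩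
      N ^ suc m * (N + K) * D          ≡⟨ regroup₂ (N ^ suc m) N K D ⟩
      N ^ suc m * (N * D + K * D)      <⟨ ℕ.*-monoʳ-< (N ^ suc m) ⦃ ℕ.m^n≢0 N (suc m) ⦄ (ℕ.+-monoʳ-< (N * D) KD<N) ⟩
      N ^ suc m * (N * D + N)          ≡⟨ regroup₃ (N ^ suc m) N D ⟩
      N ^ suc m * (N * suc D)          ≤⟨ ℕ.*-monoʳ-≤ (N ^ suc m) (ℕ.*-monoʳ-≤ N D<Pb) ⟩
      N ^ suc m * (N * (P * b))        ≡⟨ regroup₄ (N ^ suc m) N P b ⟩
      P * N ^ suc m * (b * N)          ∎))
    where
    open ≤-Reasoning
    N b : ℕ
    N = suc M + M
    b = 2 * T ^ m
    regroup₁ : ∀ c D b N → c * D * (b * N) ≡ c * b * (N * D)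
    regroup₁ = ℕ-Solver.solve-∀
    regroup₂ : ∀ Z N K D → Z * (N + K) * D ≡ Z * (N * D + K * D)
    regroup₂ = ℕ-Solver.solve-∀
    regroup₃ : ∀ Z N D → Z * (N * D + N) ≡ Z * (N * (1 + D))
    regroup₃ = ℕ-Solver.solve-∀
    regroup₄ : ∀ Z N P b → Z * (N * (P * b)) ≡ P * Z * (b * N)
    regroup₄ = ℕ-Solver.solve-∀

  density≤ : ∀ c d .⦃ _ : NonZero d ⦄ → d ≡ 2 * T ^ m * c → density (code m) ≤ᵘ fromℚ (+ c ÷ d)
  density≤ c d d≡bc = density-≤-fraction (code m) c d λ P D cD<Pd →
    -- From M = KD on, the side 2M + 1 of the cube exceeds KD.
    K * D , λ j → count< P D (K * D + j)
      (ℕ.*-cancelˡ-< c D (P * b) (subst (c * D <_) (trans (cong (P *_) d≡bc) (regroup P b c)) cD<Pd))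
      (s≤s (ℕ.≤-trans (ℕ.m≤m+n (K * D) j) (ℕ.m≤n+m (K * D + j) (K * D + j))))
    where
    b : ℕ
    b = 2 * T ^ m
    regroup : ∀ P b c → P * (b * c) ≡ c * (P * b)
    regroup = ℕ-Solver.solve-∀

-- The bound in terms of T

𝓓≤ : ∀ m r k T → 1 ≤ r → (k<r : k < r) → 2 * (r ∸ k) ≡ (suc m + 2) * T →
     𝓓 (suc m) r ≤ᵘ fromℚ (_÷_ (+ ((suc m + 2) ^ m)) (2 ^ suc m * (r ∸ k) ^ m) ⦃ denominator≢0 (suc m) k<r ⦄)
-- T = 0 would give r - k = 0, against k < r.
𝓓≤ m r k zero _ k<r eq = contradiction (trans eq (ℕ.*-zeroʳ (suc m + 2)))
  (ℕ.≢-nonZero⁻¹ (2 * (r ∸ k)) ⦃ ℕ.m*n≢0 2 (r ∸ k) ⦃ _ ⦄ ⦃ ℕ.>-nonZero (ℕ.m<n⇒0<n∸m k<r) ⦄ ⦄)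
𝓓≤ m r k T@(suc _) 1≤r k<r eq x<q =
  (code m , identifying (effectiveRadius 1≤r) wide) ,
  density≤ ((suc m + 2) ^ m) (2 ^ suc m * (r ∸ k) ^ m) ⦃ denominator≢0 (suc m) k<r ⦄ denominator x<q
  where
  open ≤-Reasoning
  open Lattice T
  open Density T m
  wide : (3 + m) * T ≤ 2 * r
  wide = begin
    (3 + m) * T       ≡⟨ cong (λ i → suc i * T) (ℕ.+-comm 2 m) ⟩
    (suc m + 2) * T   ≡⟨ eq ⟨
    2 * (r ∸ k)       ≤⟨ ℕ.*-monoʳ-≤ 2 (ℕ.m∸n≤m r k) ⟩
    2 * r             ∎
  -- By 2(r - k) = (n + 2)T with n = m + 1, the claimed fraction is (n + 2)ᵐ / (2Tᵐ(n + 2)ᵐ), which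
  -- is 1/(2Tᵐ).
  denominator : 2 ^ suc m * (r ∸ k) ^ m ≡ 2 * T ^ m * (suc m + 2) ^ m
  denominator = begin-equality
    2 * 2 ^ m * (r ∸ k) ^ m           ≡⟨ ℕ.*-assoc 2 (2 ^ m) ((r ∸ k) ^ m) ⟩
    2 * (2 ^ m * (r ∸ k) ^ m)         ≡⟨ cong (2 *_) (*-^-distribʳ 2 (r ∸ k) m) ⟨
    2 * (2 * (r ∸ k)) ^ m             ≡⟨ cong (λ i → 2 * i ^ m) eq ⟩
    2 * ((suc m + 2) * T) ^ m         ≡⟨ cong (2 *_) (*-^-distribʳ (suc m + 2) T m) ⟩
    2 * ((suc m + 2) ^ m * T ^ m)     ≡⟨ cong (2 *_) (ℕ.*-comm ((suc m + 2) ^ m) (T ^ m)) ⟩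
    2 * (T ^ m * (suc m + 2) ^ m)     ≡⟨ ℕ.*-assoc 2 (T ^ m) ((suc m + 2) ^ m) ⟨
    2 * T ^ m * (suc m + 2) ^ m       ∎

≡mod⇒∣∸ : ∀ {r k l} → k ≤ r → r ≡ k [mod l ] → l ∣ r ∸ k
≡mod⇒∣∸ {r} {k} {l} k≤r = subst (l ∣_) (cong ∣_∣ (trans (ℤ.m-n≡m⊖n r k) (ℤ.⊖-≥ k≤r)))

theorem6 : (n r k : ℕ) → 1 ≤ n → 1 ≤ r →
    ( ¬ (2 ∣ n) → (k< : k < n + 2) → (≤r : n + 2 ≤ r) → r ≡ k [mod n + 2 ] →
    𝓓 n r ≤ᵘ fromℚ (_÷_ (+ ((n + 2) ^ (n ∸ 1))) (2 ^ n * (r ∸ k) ^ (n ∸ 1)) ⦃ denominator≢0 n (<-≤-trans k< ≤r) ⦄) )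
    ×
    ( 2 ∣ n → (k< : k < (n + 2) / 2) → (≤r : (n + 2) / 2 ≤ r) → r ≡ k [mod (n + 2) / 2 ] →
    𝓓 n r ≤ᵘ fromℚ (_÷_ (+ ((n + 2) ^ (n ∸ 1))) (2 ^ n * (r ∸ k) ^ (n ∸ 1)) ⦃ denominator≢0 n (<-≤-trans k< ≤r) ⦄) )
theorem6 (suc m) r k _ 1≤r =
    (λ _ k< ≤r r≡k →
      let k<r = <-≤-trans k< ≤r
          divides t r∸k≡t[n+2] = ≡mod⇒∣∸ {r} {k} (ℕ.<⇒≤ k<r) r≡k
      -- For odd n, r - k = t(n + 2), so T = 2t.
      in 𝓓≤ m r k (2 * t) 1≤r k<r
           (trans (cong (2 *_) r∸k≡t[n+2]) (odd t (suc m + 2))))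
  , (λ 2∣n k< ≤r r≡k →
      let k<r = <-≤-trans k< ≤r
          divides t r∸k≡th = ≡mod⇒∣∸ {r} {k} (ℕ.<⇒≤ k<r) r≡k
      -- For even n, r - k = t(n + 2)/2, so T = t; evenness makes twice the truncated half equal to
      -- n + 2.
      in 𝓓≤ m r k t 1≤r k<r
           (trans (cong (2 *_) r∸k≡th) (trans (even t ((suc m + 2) / 2))
             (cong (_* t) (ℕ.m/n*n≡m (∣m∣n⇒∣m+n 2∣n ∣-refl))))))
  where
  odd : ∀ t l → 2 * (t * l) ≡ l * (2 * t)
  odd = ℕ-Solver.solve-∀
  even : ∀ t h → 2 * (t * h) ≡ h * 2 * t
  even = ℕ-Solver.solve-∀
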